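{- Let $n,m\ge1$ be integers. Then, as formal power series in $t,q$, $$\sum_{\pi\in\mathrm{PP}(\infty,n,m)}t^{\mathrm{des}(\pi)}q^{|\pi|_{uh}}=\prod_{i=1}^{m}\prod_{j=1}^{n}\frac{1}{1-t\,q^{i+j-1}}.$$
   Context: A plane partition $\pi=(\pi_{ij})_{i,j\ge1}$ is a two-dimensional array of nonnegative integers with finitely many nonzero entries such that $\pi_{ij}\ge\pi_{i+1\,j}$ and $\pi_{ij}\ge\pi_{i\,j+1}$ for all $i,j$ ($i$ is the row index, $j$ the column index). $\mathrm{PP}(\infty,n,m)$ is the set of plane partitions with at most $n$ nonzero rows and all entries at most $m$ (the number of columns is not restricted). The descent set is $\mathrm{Des}(\pi)=\{(i,j):\pi_{ij}>\pi_{i+1\,j}\}$ and $\mathrm{des}(\pi)=|\mathrm{Des}(\pi)|$. The up-hook of a cell is $\mathrm{uh}(i,j)=\pi_{ij}+i-1$ and the up-hook volume of $\pi$ is $|\pi|_{uh}=\sum_{(i,j)\in\mathrm{Des}(\pi)}\mathrm{uh}(i,j)$. -}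

module Defs where

open import Data.Bool.Base using (if_then_else_; _∧_)
open import Data.Fin.Base as Fin using (Fin; toℕ)
open import Data.Fin.Properties using (toℕ≤pred[n])
open import Data.Integer.Base as ℤ using (ℤ; 0ℤ; 1ℤ)
import Data.Integer.Properties as ℤ
open import Data.List.Base using (List; filter; foldr; deduplicate; length; map)
open import Data.List.Membership.Propositional using (_∈_)
open import Data.List.Membership.Propositional.Properties
  using (∈-filter⁺; ∈-filter⁻; ∈-deduplicate⁺)
import Data.List.Membership.Setoid as SetoidMembership
open import Data.List.Properties using (map-cong)
open import Data.List.Relation.Binary.BagAndSetEquality using (∼bag⇒↭)
open import Data.List.Membership.Propositional.Properties.WithK using (unique∧set⇒bag)
open import Data.List.Relation.Binary.Permutation.Propositional using (_↭_)
open import Data.List.Relation.Binary.Permutation.Propositional.Properties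
  using (↭-length; map⁺)
open import Data.Nat.ListAction using (sum)
open import Data.Nat.ListAction.Properties using (sum-↭)
open import Data.List.Relation.Unary.All using (All)
open import Data.List.Relation.Unary.Unique.Propositional using (Unique)
import Data.List.Relation.Unary.Unique.Propositional.Properties as Unique
import Data.List.Relation.Unary.Unique.DecPropositional.Properties as DecUnique
import Data.List.Relation.Unary.Unique.Setoid as SetoidUnique
open import Data.Nat.Base as ℕ using (ℕ; zero; suc; _≤_; _<_; _≥_; _>_; _∸_; s≤s)
import Data.Nat.Properties as ℕ
open import Data.Product.Base using (Σ-syntax; ∃-syntax; _×_; _,_; proj₁; proj₂)
open import Data.Product.Properties using (≡-dec)
open import Function.Base using (_∘_; _on_)
open import Function.Bundles using (_⇔_; mk⇔; module Equivalence)
open import Level using (0ℓ)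
open import Relation.Binary.Bundles using (Setoid)
open import Relation.Binary.Definitions using (DecidableEquality)
open import Relation.Binary.PropositionalEquality
open import Relation.Nullary.Decidable using (does)
open import Relation.Unary using (Pred; Decidable)
open import Algebra.Properties.Semiring.Sum ℤ.+-*-semiring
  using (sum-syntax; sum⁺-syntax; sum-cong-≗; ∑-distrib-+; ∑-comm;
         *-distribˡ-sum; sum-replicate-zero)

------------------------------------------------------------------------
-- Plane partitions

-- Rows and columns are numbered from 0: `entry π i j` is π_{i+1,j+1}.

record PlanePartition : Set where
  field
    entry          : ℕ → ℕ → ℕ
    row-decreasing : ∀ i j → entry i j ≥ entry (suc i) j
    col-decreasing : ∀ i j → entry i j ≥ entry i (suc j)
    finite         : Σ[ cells ∈ List (ℕ × ℕ) ]
                       (∀ i j → entry i j ≢ 0 → (i , j) ∈ cells)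

open PlanePartition public

-- Two plane partitions are equal when all their entries are, whatever the
-- list of cells used to witness finiteness of the support.

infix 4 _≐_

_≐_ : PlanePartition → PlanePartition → Set
π ≐ σ = ∀ i j → entry π i j ≡ entry σ i j

NonzeroRow : PlanePartition → Pred ℕ 0ℓ
NonzeroRow π i = ∃[ j ] entry π i j ≢ 0

AtMostNonzeroRows : ℕ → Pred PlanePartition 0ℓ
AtMostNonzeroRows n π =
  (rows : List ℕ) → Unique rows → All (NonzeroRow π) rows → length rows ≤ n

EntriesAtMost : ℕ → Pred PlanePartition 0ℓ
EntriesAtMost m π = ∀ i j → entry π i j ≤ m

PP∞ : ℕ → ℕ → Setoid 0ℓ 0ℓ
PP∞ n m = record
  { Carrier       = Σ[ π ∈ PlanePartition ] AtMostNonzeroRows n π × EntriesAtMost m π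
  ; _≈_           = _≐_ on proj₁
  ; isEquivalence = record
    { refl  = λ _ _ → refl
    ; sym   = λ p i j → sym (p i j)
    ; trans = λ p q i j → trans (p i j) (q i j)
    }
  }

------------------------------------------------------------------------
-- Descents and up-hooks

Des : PlanePartition → Pred (ℕ × ℕ) 0ℓ
Des π (i , j) = entry π i j > entry π (suc i) j

Des? : ∀ π → Decidable (Des π)
Des? π (i , j) = entry π (suc i) j ℕ.<? entry π i j

private
  _≟²_ : DecidableEquality (ℕ × ℕ)
  _≟²_ = ≡-dec ℕ._≟_ ℕ._≟_

-- A descent has a nonzero entry, so the descents are found among the cells
-- listed by `finite`; see `descents-unique` and `∈-descents`.

descents : PlanePartition → List (ℕ × ℕ)
descents π = filter (Des? π) (deduplicate _≟²_ (proj₁ (finite π)))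

des : PlanePartition → ℕ
des π = length (descents π)

-- With rows numbered from 0 the summand i - 1 becomes i.

uh : PlanePartition → ℕ × ℕ → ℕ
uh π (i , j) = entry π i j ℕ.+ i

∣_∣uh : PlanePartition → ℕ
∣ π ∣uh = sum (map (uh π) (descents π))

descents-unique : ∀ π → Unique (descents π)
descents-unique π =
  Unique.filter⁺ (Des? π) (DecUnique.deduplicate-! _≟²_ (proj₁ (finite π)))

∈-descents : ∀ π c → c ∈ descents π ⇔ Des π c
∈-descents π c@(i , j) = mk⇔
  (proj₂ ∘ ∈-filter⁻ (Des? π) {xs = deduplicate _≟²_ (proj₁ (finite π))})
  (λ d → ∈-filter⁺ (Des? π)
           (∈-deduplicate⁺ _≟²_ (proj₂ (finite π) i j (ℕ.m<n⇒n≢0 d))) d)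

descents-↭ : ∀ π σ → π ≐ σ → descents π ↭ descents σ
descents-↭ π σ π≐σ = ∼bag⇒↭ (unique∧set⇒bag (descents-unique π) (descents-unique σ)
  (λ {c} → mk⇔ (to′ π σ π≐σ c) (to′ σ π (λ i j → sym (π≐σ i j)) c)))
  where
  to′ : ∀ π σ → π ≐ σ → ∀ c → c ∈ descents π → c ∈ descents σ
  to′ π σ π≐σ c@(i , j) = Equivalence.from (∈-descents σ c)
    ∘ subst₂ _>_ (π≐σ i j) (π≐σ (suc i) j)
    ∘ Equivalence.to (∈-descents π c)

des-cong : ∀ π σ → π ≐ σ → des π ≡ des σ
des-cong π σ π≐σ = ↭-length (descents-↭ π σ π≐σ)

∣∣uh-cong : ∀ π σ → π ≐ σ → ∣ π ∣uh ≡ ∣ σ ∣uh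
∣∣uh-cong π σ π≐σ = trans
  (cong sum (map-cong (λ (i , j) → cong (ℕ._+ i) (π≐σ i j)) (descents π)))
  (sum-↭ (map⁺ (uh σ) (descents-↭ π σ π≐σ)))

------------------------------------------------------------------------
-- Formal power series in t and q over ℤ

-- `f a b` is the coefficient of t^a q^b.

PowerSeries : Set
PowerSeries = ℕ → ℕ → ℤ

infix  4 _≈_
infixl 6 _-_
infixl 7 _*_
infixr 8 _^_

_≈_ : PowerSeries → PowerSeries → Set
f ≈ g = ∀ a b → f a b ≡ g a b

t^_q^_ : ℕ → ℕ → PowerSeries
(t^ k q^ l) a b = if does (k ℕ.≟ a) ∧ does (l ℕ.≟ b) then 1ℤ else 0ℤ

𝟙 : PowerSeries
𝟙 = t^ 0 q^ 0

_-_ : PowerSeries → PowerSeries → PowerSeries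
(f - g) a b = f a b ℤ.- g a b

-- In `∑[ i ≤ a ]` the index i has type Fin (suc a).

_*_ : PowerSeries → PowerSeries → PowerSeries
(f * g) a b = ∑[ i ≤ a ] ∑[ j ≤ b ] (f (toℕ i) (toℕ j) ℤ.* g (a ∸ toℕ i) (b ∸ toℕ j))

_^_ : PowerSeries → ℕ → PowerSeries
f ^ zero  = 𝟙
f ^ suc k = f * f ^ k

-- The inverse of a power series with constant term 1, as ∑ₖ (1 - f)^k.
-- Since 1 - f has no constant term, (1 - f)^k contributes to the coefficient
-- of t^a q^b only for k ≤ a + b.  It is an inverse by `*-inverse`; if the
-- constant term is not 1 its value is meaningless.

1/_ : PowerSeries → PowerSeries
(1/ f) a b = ∑[ k ≤ a ℕ.+ b ] ((𝟙 - f) ^ toℕ k) a b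

∏₁ : ℕ → (ℕ → PowerSeries) → PowerSeries
∏₁ zero    f = 𝟙
∏₁ (suc n) f = ∏₁ n f * f (suc n)

infixl 10 ∏₁
syntax ∏₁ n (λ i → f) = ∏[1≤ i ≤ n ] f

-- `HasSum X f F`: the family (f x), x in X, is summable coefficientwise with
-- sum F.  For each monomial t^a q^b there is a finite list of distinct
-- elements of X outside which the coefficient of f x vanishes, and the
-- coefficients over the list add up to that of F.

HasSum : (X : Setoid 0ℓ 0ℓ) → (Setoid.Carrier X → PowerSeries) → PowerSeries → Set
HasSum X f F = ∀ a b → Σ[ xs ∈ List Carrier ]
    SetoidUnique.Unique X xs
  × (∀ x → f x a b ≢ 0ℤ → x ∈X xs)
  × foldr ℤ._+_ 0ℤ (map (λ x → f x a b) xs) ≡ F a b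
  where
  open Setoid X using (Carrier)
  open SetoidMembership X using () renaming (_∈_ to _∈X_)

------------------------------------------------------------------------
-- `1/_` is an inverse

private
  ∑-zero : ∀ {n} (f : Fin n → ℤ) → (∀ i → f i ≡ 0ℤ) → ∑[ i < n ] f i ≡ 0ℤ
  ∑-zero {n} f f≡0 = trans (sum-cong-≗ f≡0) (sum-replicate-zero n)

  *-identityˡ : ∀ f → 𝟙 * f ≈ f
  *-identityˡ f a b = begin
    (1ℤ ℤ.* f a b ℤ.+ rest₁) ℤ.+ rest₂  ≡⟨ cong₂ ℤ._+_ (cong₂ ℤ._+_ (ℤ.*-identityˡ (f a b)) rest₁≡0) rest₂≡0 ⟩
    (f a b ℤ.+ 0ℤ) ℤ.+ 0ℤ               ≡⟨ ℤ.+-identityʳ _ ⟩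
    f a b ℤ.+ 0ℤ                        ≡⟨ ℤ.+-identityʳ _ ⟩
    f a b                               ∎
    where
    open ≡-Reasoning
    rest₁ = ∑[ j < b ] (0ℤ ℤ.* f a (b ∸ suc (toℕ j)))
    rest₂ = ∑[ i < a ] ∑[ j ≤ b ] (0ℤ ℤ.* f (a ∸ suc (toℕ i)) (b ∸ toℕ j))
    rest₁≡0 : rest₁ ≡ 0ℤ
    rest₁≡0 = ∑-zero {b} _ (λ j → ℤ.*-zeroˡ (f a (b ∸ suc (toℕ j))))
    rest₂≡0 : rest₂ ≡ 0ℤ
    rest₂≡0 = ∑-zero {a} _ (λ i → ∑-zero {suc b} _ (λ j →
      ℤ.*-zeroˡ (f (a ∸ suc (toℕ i)) (b ∸ toℕ j))))

  ^-vanishes : ∀ u → u 0 0 ≡ 0ℤ → ∀ k a b → a ℕ.+ b < k → (u ^ k) a b ≡ 0ℤ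
  ^-vanishes u u₀ (suc k) a b (s≤s a+b≤k) =
    ∑-zero {suc a} _ (λ i → ∑-zero {suc b} _ (λ j →
      term (toℕ i) (toℕ j) (toℕ≤pred[n] i) (toℕ≤pred[n] j)))
    where
    rest : ∀ i j → (a ∸ i) ℕ.+ (b ∸ j) < a ℕ.+ b →
           u i j ℤ.* (u ^ k) (a ∸ i) (b ∸ j) ≡ 0ℤ
    rest i j lt = trans
      (cong (u i j ℤ.*_) (^-vanishes u u₀ k (a ∸ i) (b ∸ j) (ℕ.<-≤-trans lt a+b≤k)))
      (ℤ.*-zeroʳ (u i j))
    term : ∀ i j → i ≤ a → j ≤ b → u i j ℤ.* (u ^ k) (a ∸ i) (b ∸ j) ≡ 0ℤ
    term zero    zero    _   _   = cong (ℤ._* (u ^ k) a b) u₀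
    term zero    (suc j) _   j<b = rest zero (suc j)
      (ℕ.+-monoʳ-< a (ℕ.∸-monoʳ-< (ℕ.0<1+n {j}) j<b))
    term (suc i) j       i<a _   = rest (suc i) j
      (ℕ.+-mono-<-≤ (ℕ.∸-monoʳ-< (ℕ.0<1+n {i}) i<a) (ℕ.m∸n≤m b j))

  ∑-extend : ∀ (g : ℕ → ℤ) {m n} → m ≤ n → (∀ k → m ≤ k → g k ≡ 0ℤ) →
             ∑[ k < m ] g (toℕ k) ≡ ∑[ k < n ] g (toℕ k)
  ∑-extend g {n = n} ℕ.z≤n g≡0 = sym (∑-zero {n} _ (λ k → g≡0 (toℕ k) ℕ.z≤n))
  ∑-extend g (s≤s m≤n) g≡0 =
    cong (ℤ._+_ (g 0)) (∑-extend (g ∘ suc) m≤n (λ k m≤k → g≡0 (suc k) (s≤s m≤k)))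

  telescope : ∀ (g h : ℕ → ℤ) → (∀ k → g k ℤ.+ h (suc k) ≡ h k) →
              ∀ n → ∑[ k < n ] g (toℕ k) ℤ.+ h n ≡ h 0
  telescope g h step zero    = ℤ.+-identityˡ (h 0)
  telescope g h step (suc n) = begin
    (g 0 ℤ.+ s) ℤ.+ h (suc n)  ≡⟨ ℤ.+-assoc (g 0) s (h (suc n)) ⟩
    g 0 ℤ.+ (s ℤ.+ h (suc n))  ≡⟨ cong (ℤ._+_ (g 0)) (telescope (g ∘ suc) (h ∘ suc) (step ∘ suc) n) ⟩
    g 0 ℤ.+ h 1                ≡⟨ step 0 ⟩
    h 0                        ∎
    where
    open ≡-Reasoning
    s = ∑[ k < n ] g (suc (toℕ k))

  *-split : ∀ f g a b → (f * g) a b ℤ.+ ((𝟙 - f) * g) a b ≡ g a b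
  *-split f g a b = begin
    (f * g) a b ℤ.+ ((𝟙 - f) * g) a b
      ≡⟨ ∑-distrib-+ {suc a} (λ i → ∑[ j ≤ b ] T f i j) (λ i → ∑[ j ≤ b ] T (𝟙 - f) i j) ⟨
    ∑[ i ≤ a ] (∑[ j ≤ b ] T f i j ℤ.+ ∑[ j ≤ b ] T (𝟙 - f) i j)
      ≡⟨ sum-cong-≗ {suc a} (λ i → trans
           (sym (∑-distrib-+ {suc b} (T f i) (T (𝟙 - f) i)))
           (sum-cong-≗ {suc b} (merge i))) ⟩
    (𝟙 * g) a b
      ≡⟨ *-identityˡ g a b ⟩
    g a b ∎
    where
    open ≡-Reasoning
    T : PowerSeries → Fin (suc a) → Fin (suc b) → ℤ
    T h i j = h (toℕ i) (toℕ j) ℤ.* g (a ∸ toℕ i) (b ∸ toℕ j)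
    cancel : ∀ x y → x ℤ.+ (y ℤ.- x) ≡ y
    cancel x y = begin
      x ℤ.+ (y ℤ.- x)        ≡⟨ ℤ.+-comm x (y ℤ.- x) ⟩
      (y ℤ.- x) ℤ.+ x        ≡⟨ ℤ.+-assoc y (ℤ.- x) x ⟩
      y ℤ.+ (ℤ.- x ℤ.+ x)    ≡⟨ cong (ℤ._+_ y) (ℤ.+-inverseˡ x) ⟩
      y ℤ.+ 0ℤ               ≡⟨ ℤ.+-identityʳ y ⟩
      y                      ∎
    merge : ∀ i j → T f i j ℤ.+ T (𝟙 - f) i j ≡ T 𝟙 i j
    merge i j = trans
      (sym (ℤ.*-distribʳ-+ (g (a ∸ toℕ i) (b ∸ toℕ j)) (f (toℕ i) (toℕ j)) _))
      (cong (ℤ._* g (a ∸ toℕ i) (b ∸ toℕ j)) (cancel (f (toℕ i) (toℕ j)) (𝟙 (toℕ i) (toℕ j))))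

*-inverse : ∀ f → f 0 0 ≡ 1ℤ → f * (1/ f) ≈ 𝟙
*-inverse f f₀ a b = begin
  (f * (1/ f)) a b
    ≡⟨ sum-cong-≗ {suc a} (λ i → sum-cong-≗ {suc b} (λ j → expand i j)) ⟩
  ∑[ i ≤ a ] ∑[ j ≤ b ] ∑[ k ≤ N ] T i j k
    ≡⟨ sum-cong-≗ {suc a} (λ i → ∑-comm {suc b} {suc N} (T i)) ⟩
  ∑[ i ≤ a ] ∑[ k ≤ N ] ∑[ j ≤ b ] T i j k
    ≡⟨ ∑-comm {suc a} {suc N} (λ i k → ∑[ j ≤ b ] T i j k) ⟩
  S
    ≡⟨ ℤ.+-identityʳ S ⟨
  S ℤ.+ 0ℤ
    ≡⟨ cong (ℤ._+_ S) (^-vanishes u u₀ (suc N) a b ℕ.≤-refl) ⟨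
  S ℤ.+ (u ^ suc N) a b
    ≡⟨ telescope (λ k → (f * u ^ k) a b) (λ k → (u ^ k) a b) (λ k → *-split f (u ^ k) a b) (suc N) ⟩
  𝟙 a b ∎
  where
  open ≡-Reasoning
  N = a ℕ.+ b
  u = 𝟙 - f
  u₀ : u 0 0 ≡ 0ℤ
  u₀ = cong (ℤ._-_ 1ℤ) f₀
  T : Fin (suc a) → Fin (suc b) → Fin (suc N) → ℤ
  T i j k = f (toℕ i) (toℕ j) ℤ.* (u ^ toℕ k) (a ∸ toℕ i) (b ∸ toℕ j)
  S = ∑[ k ≤ N ] (f * u ^ toℕ k) a b
  expand : ∀ i j → f (toℕ i) (toℕ j) ℤ.* (1/ f) (a ∸ toℕ i) (b ∸ toℕ j) ≡ ∑[ k ≤ N ] T i j k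
  expand i j = trans
    (cong (f (toℕ i) (toℕ j) ℤ.*_) (∑-extend (λ k → (u ^ k) (a ∸ toℕ i) (b ∸ toℕ j))
      (s≤s (ℕ.+-mono-≤ (ℕ.m∸n≤m a (toℕ i)) (ℕ.m∸n≤m b (toℕ j))))
      (λ k → ^-vanishes u u₀ k (a ∸ toℕ i) (b ∸ toℕ j))))
    (*-distribˡ-sum {suc N} (f (toℕ i) (toℕ j)) (λ k → (u ^ toℕ k) (a ∸ toℕ i) (b ∸ toℕ j)))

{-# OPTIONS --safe #-}

-- A descent of π is a corner of the Young diagram of one of its columns.  Let
-- d(i,ℓ) be the number of columns with a corner in row i at value ℓ.  Then
-- des π = ∑ d(i,ℓ) and |π|_uh = ∑ d(i,ℓ)·(i+ℓ-1), so it is enough to see that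
-- π ↦ d is a bijection onto the n × m matrices over ℕ.  Since the columns are
-- nested, the support of d generates the first column as an order ideal;
-- subtracting the corners of that column from d leaves the matrix of the
-- remaining columns, and so on until d is exhausted.

module Submission where

open import Defs
open import Data.Nat.Base using (ℕ; _≥_; _+_; _∸_)
open import Data.Product.Base using (_,_)

import Algebra.Properties.CommutativeSemigroup as CommutativeSemigroup
open import Data.Bool.Base using (if_then_else_)
open import Data.Empty using (⊥-elim)
open import Data.Fin.Base using (Fin; toℕ; fromℕ<) renaming (zero to fzero; suc to fsuc)
open import Data.Fin.Properties using (toℕ-fromℕ<; toℕ-injective; toℕ≤pred[n])
open import Data.Integer.Base as ℤ using (ℤ; 0ℤ; 1ℤ)
import Data.Integer.Properties as ℤ
open import Data.List.Base
  using (List; []; _∷_; _++_; length; map; concat; tabulate; cartesianProduct; filter; upTo;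
         applyUpTo; foldr)
open import Data.List.Extrema.Nat using (max; xs≤max)
open import Data.List.Membership.Propositional using (_∈_)
open import Data.List.Membership.Propositional.Properties hiding (finite)
open import Data.List.Membership.Propositional.Properties.WithK using (unique∧set⇒bag)
import Data.List.Membership.Setoid as SetoidMembership
import Data.List.Membership.Setoid.Properties as SetoidMembershipProperties
open import Data.List.Properties
  using (length-map; length-++; map-upTo; map-++; map-∘; length-upTo; length-filter)
open import Data.List.Relation.Binary.BagAndSetEquality using (∼bag⇒↭)
open import Data.List.Relation.Binary.Permutation.Propositional using (_↭_)
open import Data.List.Relation.Binary.Permutation.Propositional.Properties using (map⁺; ↭-length)
open import Data.List.Relation.Unary.All as All using (All; [])
import Data.List.Relation.Unary.All.Properties as All
open import Data.List.Relation.Unary.AllPairs using ([]; _∷_)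
import Data.List.Relation.Unary.AllPairs.Properties as AllPairs
open import Data.List.Relation.Unary.Any using (here; there)
open import Data.List.Relation.Unary.Unique.Propositional using (Unique)
import Data.List.Relation.Unary.Unique.Propositional.Properties as Unique
import Data.List.Relation.Unary.Unique.Setoid.Properties as SetoidUnique
open import Data.Nat.Base as ℕ using (zero; suc; _≤_; _<_; z≤n; s≤s)
open import Data.Nat.ListAction using (sum)
open import Data.Nat.ListAction.Properties using (sum-++; sum-↭)
import Data.Nat.Properties as ℕ
open import Data.Product.Base using (Σ-syntax; ∃-syntax; _×_; proj₁; proj₂)
open import Data.Sum.Base using (inj₁; inj₂)
open import Data.Unit.Base using (⊤; tt)
open import Data.Vec.Base as Vec using (Vec; []; _∷_)
open import Function.Base using (_∘_; id; const; flip)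
open import Function.Bundles using (mk⇔; module Equivalence)
open import Level using (0ℓ)
open import Relation.Binary.Bundles using (Setoid)
open import Relation.Binary.PropositionalEquality hiding ([_]; J)
open import Relation.Nullary.Decidable using (Dec; yes; no; does; _×-dec_; dec-true)
open import Relation.Nullary.Negation.Core using (¬_)
open import Relation.Unary using (Pred; Decidable)
open import Algebra.Properties.Semiring.Sum ℤ.+-*-semiring using (sum-syntax)
open import Data.List.Membership.DecPropositional ℕ._≟_ using (_∈?_)

-- Counting by power series

-- Why the support of `d` determines the first column: every column lies inside the first, hence so
-- does each of its corners, while the corners of the first column by themselves generate it. Why
-- peeling works for an arbitrary matrix: the corners of the generated ideal are maximal elements of
-- the support, so each can be subtracted once. The support can only shrink, so the next ideal lies
-- inside the previous one, and the total of the entries falls until nothing is left. The product is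
-- never expanded. Each factor is read as the generating function of ℕ, so a coefficient of the
-- product is the number of matrices with prescribed weights. Partitions with equal entries may
-- carry different finiteness witnesses. The sum is therefore listed by matrices, along a map to
-- partitions that is injective and is surjective up to `_≐_`.

record Enumerates {X : Set} (P : Pred X 0ℓ) (z : ℤ) : Set where
  field
    elements    : List X
    unique      : Unique elements
    sound       : ∀ {x} → x ∈ elements → P x
    complete    : ∀ {x} → P x → x ∈ elements
    cardinality : ℤ.+ length elements ≡ z

open Enumerates

resize : ∀ {X} {P : Pred X 0ℓ} {y z} → y ≡ z → Enumerates P y → Enumerates P z
resize {P = P} y≡z = subst (Enumerates P) y≡z

transport : ∀ {X Y} {P : Pred X 0ℓ} {Q : Pred Y 0ℓ} {z} (f : X → Y) →
            (∀ {x y} → f x ≡ f y → x ≡ y) → (∀ {x} → P x → Q (f x)) →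
            (∀ {y} → Q y → ∃[ x ] P x × y ≡ f x) → Enumerates P z → Enumerates Q z
transport {Q = Q} f f-injective P⇒Q Q⇒P e = record
  { elements    = map f (elements e)
  ; unique      = Unique.map⁺ f-injective (unique e)
  ; sound       = λ y∈ → let (_ , x∈ , y≡fx) = ∈-map⁻ f y∈ in
                         subst Q (sym y≡fx) (P⇒Q (sound e x∈))
  ; complete    = λ q → let (_ , p , y≡fx) = Q⇒P q in
                        subst (_∈ map f (elements e)) (sym y≡fx) (∈-map⁺ f (complete e p))
  ; cardinality = trans (cong ℤ.+_ (length-map f (elements e))) (cardinality e)
  }

respects : ∀ {X} {P Q : Pred X 0ℓ} {z} → (∀ {x} → P x → Q x) → (∀ {x} → Q x → P x) →
           Enumerates P z → Enumerates Q z
respects P⇒Q Q⇒P = transport id id P⇒Q (λ q → _ , Q⇒P q , refl)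

length-cartesianProduct : ∀ {X Y : Set} (xs : List X) (ys : List Y) →
  length (cartesianProduct xs ys) ≡ length xs ℕ.* length ys
length-cartesianProduct []       ys = refl
length-cartesianProduct (x ∷ xs) ys = trans (length-++ (map (x ,_) ys))
  (cong₂ _+_ (length-map (x ,_) ys) (length-cartesianProduct xs ys))

enumerates-× : ∀ {X Y} {P : Pred X 0ℓ} {Q : Pred Y 0ℓ} {y z} →
               Enumerates P y → Enumerates Q z →
               Enumerates (λ (x , y) → P x × Q y) (y ℤ.* z)
enumerates-× e f = record
  { elements    = cartesianProduct (elements e) (elements f)
  ; unique      = Unique.cartesianProduct⁺ (unique e) (unique f)
  ; sound       = λ xy∈ → let (x∈ , y∈) = ∈-cartesianProduct⁻ (elements e) (elements f) xy∈ in
                          sound e x∈ , sound f y∈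
  ; complete    = λ (p , q) → ∈-cartesianProduct⁺ (complete e p) (complete f q)
  ; cardinality = trans (cong ℤ.+_ (length-cartesianProduct (elements e) (elements f)))
                    (trans (ℤ.pos-* (length (elements e)) (length (elements f)))
                      (cong₂ ℤ._*_ (cardinality e) (cardinality f)))
  }

length-concat-tabulate : ∀ {X : Set} {n} (xs : Fin n → List X) (z : Fin n → ℤ) →
  (∀ i → ℤ.+ length (xs i) ≡ z i) → ℤ.+ length (concat (tabulate xs)) ≡ ∑[ i < n ] z i
length-concat-tabulate {n = zero}  xs z eq = refl
length-concat-tabulate {n = suc n} xs z eq =
  trans (cong ℤ.+_ (length-++ (xs fzero)))
    (trans (ℤ.pos-+ (length (xs fzero)) _)
      (cong₂ ℤ._+_ (eq fzero) (length-concat-tabulate (xs ∘ fsuc) (z ∘ fsuc) (eq ∘ fsuc))))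

enumerates-∑ : ∀ {X n} {P : Fin n → Pred X 0ℓ} {z : Fin n → ℤ} →
               (∀ {i j x} → P i x → P j x → i ≡ j) → (∀ i → Enumerates (P i) (z i)) →
               Enumerates (λ x → ∃[ i ] P i x) (∑[ i < n ] z i)
enumerates-∑ {n = n} disjoint e = record
  { elements    = concat (tabulate (elements ∘ e))
  ; unique      = Unique.concat⁺ (All.tabulate⁺ (unique ∘ e))
                    (AllPairs.tabulate⁺ (λ i≢j (x∈ , x∈′) →
                      i≢j (disjoint (sound (e _) x∈) (sound (e _) x∈′))))
  ; sound       = λ x∈ → sound′ (∈-concat⁻′ (tabulate (elements ∘ e)) x∈)
  ; complete    = λ (i , p) → ∈-concat⁺′ (complete (e i) p) (∈-tabulate⁺ i)
  ; cardinality = length-concat-tabulate (elements ∘ e) _ (cardinality ∘ e)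
  }
  where
  sound′ : ∀ {x} → ∃[ ys ] x ∈ ys × ys ∈ tabulate (elements ∘ e) → ∃[ i ] _
  sound′ (_ , x∈ys , ys∈) with i , refl ← ∈-tabulate⁻ ys∈ = i , sound (e i) x∈ys

-- `f` is the bivariate generating function of `X` for the weights `dt` and `dq`; in particular all
-- fibres are finite.
Counts : PowerSeries → (X : Set) → (X → ℕ) → (X → ℕ) → Set
Counts f X dt dq = ∀ a b → Enumerates {X} (λ x → dt x ≡ a × dq x ≡ b) (f a b)

≡-+∸ : ∀ {k l a} → k + l ≡ a → Σ[ i ∈ Fin (suc a) ] k ≡ toℕ i × l ≡ a ∸ toℕ i
≡-+∸ {k} {l} refl = fromℕ< k< , sym i≡k , trans (sym (ℕ.m+n∸m≡n k l)) (cong (k + l ∸_) (sym i≡k))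
  where
  k< : k < suc (k + l)
  k< = s≤s (ℕ.m≤m+n k l)
  i≡k : toℕ (fromℕ< k<) ≡ k
  i≡k = toℕ-fromℕ< k<

+∸-≡ : ∀ {k l a} (i : Fin (suc a)) → k ≡ toℕ i → l ≡ a ∸ toℕ i → k + l ≡ a
+∸-≡ i refl refl = ℕ.m+[n∸m]≡n (toℕ≤pred[n] i)

-- The weights of the first component pick the one term `(i , j)` of the convolution in which a pair
-- is counted. This makes the terms disjoint and exhaustive.
counts-* : ∀ {f g X Y dt dq dt′ dq′} → Counts f X dt dq → Counts g Y dt′ dq′ →
           Counts (f * g) (X × Y) (λ (x , y) → dt x + dt′ y) (λ (x , y) → dq x + dq′ y)
counts-* {X = X} {Y} {dt} {dq} {dt′} {dq′} cf cg a b =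
  respects
    (λ (i , j , (t , q) , (t′ , q′)) → +∸-≡ i t t′ , +∸-≡ j q q′)
    (λ (t , q) → let (i , t₁ , t₂) = ≡-+∸ t ; (j , q₁ , q₂) = ≡-+∸ q in
                 i , j , (t₁ , q₁) , (t₂ , q₂))
    (enumerates-∑ {P = λ i xy → ∃[ j ] P i j xy}
      (λ (_ , (t , _) , _) (_ , (t′ , _) , _) → toℕ-injective (trans (sym t) t′))
      (λ i → enumerates-∑ {P = P i}
        (λ ((_ , q) , _) ((_ , q′) , _) → toℕ-injective (trans (sym q) q′))
        (λ j → enumerates-× (cf (toℕ i) (toℕ j)) (cg (a ∸ toℕ i) (b ∸ toℕ j)))))
  where
  P : Fin (suc a) → Fin (suc b) → Pred (X × Y) 0ℓ
  P i j (x , y) = (dt x ≡ toℕ i × dq x ≡ toℕ j) × (dt′ y ≡ a ∸ toℕ i × dq′ y ≡ b ∸ toℕ j)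

t^q^-≡1 : ∀ {k l a b} → k ≡ a → l ≡ b → (t^ k q^ l) a b ≡ 1ℤ
t^q^-≡1 {k} {l} {a} {b} k≡a l≡b =
  cong (λ t → if t then 1ℤ else 0ℤ) (dec-true ((k ℕ.≟ a) ×-dec (l ℕ.≟ b)) (k≡a , l≡b))

counts-t^q^ : ∀ k l → Counts (t^ k q^ l) ⊤ (const k) (const l)
counts-t^q^ k l a b with (k ℕ.≟ a) ×-dec (l ℕ.≟ b) in eq
... | yes (k≡a , l≡b) = record
  { elements    = tt ∷ []
  ; unique      = [] ∷ []
  ; sound       = λ _ → k≡a , l≡b
  ; complete    = λ _ → here refl
  ; cardinality = sym (t^q^-≡1 k≡a l≡b)
  }
... | no k,l≢a,b      = record
  { elements    = []
  ; unique      = []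
  ; sound       = λ ()
  ; complete    = λ k,l≡a,b → ⊥-elim (k,l≢a,b k,l≡a,b)
  ; cardinality = sym (cong (λ d → if does d then 1ℤ else 0ℤ) eq)
  }

counts-respects : ∀ {f g X Y dt dq dt′ dq′} → f ≈ g → (to : X → Y) (from : Y → X) →
                  (∀ x → from (to x) ≡ x) → (∀ y → to (from y) ≡ y) →
                  (∀ x → dt′ (to x) ≡ dt x) → (∀ x → dq′ (to x) ≡ dq x) →
                  Counts f X dt dq → Counts g Y dt′ dq′
counts-respects {dt = dt} {dq} {dt′} {dq′} f≈g to from from∘to to∘from t q c a b =
  resize (f≈g a b) (transport to
    (λ {x} {y} eq → trans (sym (from∘to x)) (trans (cong from eq) (from∘to y)))
    (λ {x} (ta , qb) → trans (t x) ta , trans (q x) qb)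
    (λ {y} (ta , qb) → from y
       , (trans (trans (sym (t (from y))) (cong dt′ (to∘from y))) ta
         , trans (trans (sym (q (from y))) (cong dq′ (to∘from y))) qb)
       , sym (to∘from y))
    (c a b))

-- A monomial counts a one-element set and `⊤ × ⊤` is again `⊤`, so powers of a monomial come
-- straight from `counts-*`.
counts-^ : ∀ {f w} → Counts f ⊤ (const 1) (const w) →
           ∀ k → Counts (f ^ k) ⊤ (const k) (const (k ℕ.* w))
counts-^ c zero    = counts-t^q^ 0 0
counts-^ c (suc k) =
  counts-respects (λ _ _ → refl) (λ _ → tt) (λ _ → tt , tt) (λ _ → refl) (λ _ → refl)
    (λ _ → refl) (λ _ → refl) (counts-* c (counts-^ c k))

-- The `k`-th term of the geometric series counts the single number `k`. A number of weight `a` is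
-- `a` itself, so cutting the series off at `a + b` loses nothing.
counts-1/ : ∀ w → Counts (1/ (𝟙 - (t^ 1 q^ w))) ℕ id (ℕ._* w)
counts-1/ w a b =
  respects
    (λ { (i , _ , refl , t , q) → t , q })
    (λ {x} (t , q) →
      let x< = s≤s (ℕ.≤-trans (ℕ.≤-reflexive t) (ℕ.m≤m+n a b)) ; i≡ = toℕ-fromℕ< x< in
      fromℕ< x< , tt , sym i≡ , t , q)
    (enumerates-∑ {n = suc (a + b)}
      (λ (_ , x≡i , _) (_ , x≡j , _) → toℕ-injective (trans (sym x≡i) x≡j))
      (λ i → transport {Q = λ x → ⊤ × x ≡ toℕ i × x ≡ a × x ℕ.* w ≡ b} (λ _ → toℕ i) (λ _ → refl)
        (λ (t , q) → tt , refl , t , q)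
        (λ { (_ , refl , t , q) → tt , (t , q) , refl })
        (counts-^ u-counts (toℕ i) a b)))
  where
  u : PowerSeries
  u = 𝟙 - (𝟙 - (t^ 1 q^ w))
  u≈ : (t^ 1 q^ w) ≈ u
  u≈ a b = sym (begin
    x ℤ.- (x ℤ.- y)              ≡⟨ cong (ℤ._+_ x) (ℤ.neg-distrib-+ x (ℤ.- y)) ⟩
    x ℤ.+ (ℤ.- x ℤ.+ ℤ.- ℤ.- y)  ≡⟨ ℤ.+-assoc x (ℤ.- x) _ ⟨
    (x ℤ.- x) ℤ.+ ℤ.- ℤ.- y      ≡⟨ cong₂ ℤ._+_ (ℤ.+-inverseʳ x) (ℤ.neg-involutive y) ⟩
    0ℤ ℤ.+ y                     ≡⟨ ℤ.+-identityˡ y ⟩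
    y                            ∎)
    where
    open ≡-Reasoning
    x = 𝟙 a b
    y = (t^ 1 q^ w) a b
  u-counts : Counts u ⊤ (const 1) (const w)
  u-counts = counts-respects u≈ id id (λ _ → refl) (λ _ → refl) (λ _ → refl) (λ _ → refl)
    (counts-t^q^ 1 w)

-- The head of a vector of length n carries the index n, since ∏₁ multiplies
-- the factor of largest index last.
total : ∀ {X : Set} → (ℕ → X → ℕ) → ∀ {n} → Vec X n → ℕ
total d []               = 0
total d {suc n} (x ∷ xs) = total d xs + d (suc n) x

counts-∏₁ : ∀ {X : Set} {f : ℕ → PowerSeries} {dt dq : ℕ → X → ℕ} →
            (∀ i → Counts (f i) X (dt i) (dq i)) →
            ∀ n → Counts (∏₁ n f) (Vec X n) (total dt) (total dq)
counts-∏₁ c zero    = counts-respects (λ _ _ → refl) (λ _ → []) (λ _ → tt) (λ _ → refl)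
  (λ { [] → refl }) (λ _ → refl) (λ _ → refl) (counts-t^q^ 0 0)
counts-∏₁ c (suc n) = counts-respects (λ _ _ → refl) (λ (xs , x) → x ∷ xs)
  (λ xs → Vec.tail xs , Vec.head xs) (λ _ → refl) (λ { (_ ∷ _) → refl }) (λ _ → refl) (λ _ → refl)
  (counts-* (counts-∏₁ c n) (c (suc n)))

-- Finite sums of natural numbers

∑< : ℕ → (ℕ → ℕ) → ℕ
∑< zero    f = 0
∑< (suc n) f = ∑< n f + f n

∑<-cong : ∀ n {f g} → (∀ {i} → i < n → f i ≡ g i) → ∑< n f ≡ ∑< n g
∑<-cong zero    f≡g = refl
∑<-cong (suc n) f≡g = cong₂ _+_ (∑<-cong n (f≡g ∘ ℕ.m<n⇒m<1+n)) (f≡g ℕ.≤-refl)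

∑<-zero : ∀ n → ∑< n (const 0) ≡ 0
∑<-zero zero    = refl
∑<-zero (suc n) = trans (ℕ.+-identityʳ _) (∑<-zero n)

∑<-front : ∀ n f → ∑< (suc n) f ≡ f 0 + ∑< n (f ∘ suc)
∑<-front zero    f = sym (ℕ.+-identityʳ (f 0))
∑<-front (suc n) f = trans (cong (_+ f (suc n)) (∑<-front n f)) (ℕ.+-assoc (f 0) _ _)

∑<-+ : ∀ n f g → ∑< n (λ i → f i + g i) ≡ ∑< n f + ∑< n g
∑<-+ zero    f g = refl
∑<-+ (suc n) f g = trans (cong (_+ (f n + g n)) (∑<-+ n f g))
  (CommutativeSemigroup.interchange ℕ.+-commutativeSemigroup (∑< n f) (∑< n g) (f n) (g n))

∑<-comm : ∀ n m (f : ℕ → ℕ → ℕ) → ∑< n (λ i → ∑< m (f i)) ≡ ∑< m (λ j → ∑< n (λ i → f i j))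
∑<-comm zero    m f = sym (∑<-zero m)
∑<-comm (suc n) m f = trans (cong (_+ ∑< m (f n)) (∑<-comm n m f)) (sym (∑<-+ m _ (f n)))

∑<-*ʳ : ∀ n f x → ∑< n f ℕ.* x ≡ ∑< n (λ i → f i ℕ.* x)
∑<-*ʳ zero    f x = refl
∑<-*ʳ (suc n) f x = trans (ℕ.*-distribʳ-+ x (∑< n f) (f n)) (cong (_+ f n ℕ.* x) (∑<-*ʳ n f x))

term≤∑< : ∀ {n i} f → i < n → f i ≤ ∑< n f
term≤∑< {suc n} {i} f i<1+n with ℕ.m≤n⇒m<n∨m≡n (ℕ.≤-pred i<1+n)
... | inj₁ i<n  = ℕ.m≤n⇒m≤n+o (f n) (term≤∑< f i<n)
... | inj₂ refl = ℕ.m≤n+m (f i) (∑< i f)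

∑<≢0 : ∀ n f → ∑< n f ≢ 0 → ∃[ i ] i < n × f i ≢ 0
∑<≢0 zero    f ≢0 = ⊥-elim (≢0 refl)
∑<≢0 (suc n) f ≢0 with f n ℕ.≟ 0
... | no  fn≢0 = n , ℕ.≤-refl , fn≢0
... | yes fn≡0 = let (i , i<n , fi≢0) = ∑<≢0 n f (λ ≡0 → ≢0 (cong₂ _+_ ≡0 fn≡0)) in
                 i , ℕ.m<n⇒m<1+n i<n , fi≢0

∑<-single : ∀ {n k} f → k < n → (∀ i → i ≢ k → f i ≡ 0) → ∑< n f ≡ f k
∑<-single {suc n} {k} f k<1+n f≡0 with ℕ.m≤n⇒m<n∨m≡n (ℕ.≤-pred k<1+n)
... | inj₁ k<n  = trans (cong₂ _+_ (∑<-single f k<n f≡0) (f≡0 n (ℕ.>⇒≢ k<n))) (ℕ.+-identityʳ (f k))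
... | inj₂ refl = cong (_+ f k) (trans (∑<-cong k (λ {i} i<k → f≡0 i (ℕ.<⇒≢ i<k))) (∑<-zero k))

iverson : ∀ {P : Set} → Dec P → ℕ
iverson d = if does d then 1 else 0

iverson-true : ∀ {P} (d : Dec P) → P → iverson d ≡ 1
iverson-true (yes _) _ = refl
iverson-true (no ¬p) p = ⊥-elim (¬p p)

iverson-false : ∀ {P} (d : Dec P) → ¬ P → iverson d ≡ 0
iverson-false (yes p) ¬p = ⊥-elim (¬p p)
iverson-false (no _)  _  = refl

iverson-cong : ∀ {P Q} (d : Dec P) (e : Dec Q) → (P → Q) → (Q → P) → iverson d ≡ iverson e
iverson-cong (yes p) e P⇒Q Q⇒P = sym (iverson-true e (P⇒Q p))
iverson-cong (no ¬p) e P⇒Q Q⇒P = sym (iverson-false e (¬p ∘ Q⇒P))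

iverson-≤ : ∀ {P x} (d : Dec P) → (P → 1 ≤ x) → iverson d ≤ x
iverson-≤ (yes p) 1≤ = 1≤ p
iverson-≤ (no _)  _  = z≤n

iverson≢0 : ∀ {P} (d : Dec P) → iverson d ≢ 0 → P
iverson≢0 (yes p) _  = p
iverson≢0 (no _)  ≢0 = ⊥-elim (≢0 refl)

-- Corners of columns

-- The index ℓ stands for the value ℓ + 1, since the entry at a descent is nonzero.
Drop : ℕ → ℕ → ℕ → Set
Drop x y ℓ = x ≡ suc ℓ × y < x

drop? : ∀ x y ℓ → Dec (Drop x y ℓ)
drop? x y ℓ = (x ℕ.≟ suc ℓ) ×-dec (y ℕ.<? x)

corner : (ℕ → ℕ) → ℕ → ℕ → ℕ
corner c i ℓ = iverson (drop? (c i) (c (suc i)) ℓ)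

corner-zero : ∀ {c i ℓ} → c i ≡ 0 → corner c i ℓ ≡ 0
corner-zero ci≡0 rewrite ci≡0 = refl

corner-at : ∀ {c i ℓ} → c i ≡ suc ℓ → c (suc i) < c i → corner c i ℓ ≡ 1
corner-at {c} {i} {ℓ} eq lt = iverson-true (drop? (c i) (c (suc i)) ℓ) (eq , lt)

corner≢0 : ∀ {c i ℓ} → corner c i ℓ ≢ 0 → Drop (c i) (c (suc i)) ℓ
corner≢0 {c} {i} {ℓ} = iverson≢0 (drop? (c i) (c (suc i)) ℓ)

module _ {n : ℕ} {c : ℕ → ℕ} (c↓ : ∀ i → c (suc i) ≤ c i) (c≡0 : ∀ i → n ≤ i → c i ≡ 0) where

  -- Follow the column down from row `i` while its value stays `suc ℓ`. It vanishes from row `n` on,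
  -- so it has to drop; the fuel `k` in `go` bounds the distance to row `n`.
  corner-below : ∀ {i ℓ} → c i ≡ suc ℓ → ∃[ i′ ] i ≤ i′ × corner c i′ ℓ ≡ 1
  corner-below {i} = go n i (ℕ.m≤m+n n i)
    where
    go : ∀ k i {ℓ} → n ≤ k + i → c i ≡ suc ℓ → ∃[ i′ ] i ≤ i′ × corner c i′ ℓ ≡ 1
    go zero    i n≤i ci≡ with () ← trans (sym (c≡0 i n≤i)) ci≡
    go (suc k) i n≤ ci≡ with c (suc i) ℕ.<? c i
    ... | yes lt = i , ℕ.≤-refl , corner-at {c} ci≡ lt
    ... | no ≮   =
      let (i′ , i<i′ , eq) = go k (suc i) (subst (n ≤_) (sym (ℕ.+-suc k i)) n≤)
                               (trans (ℕ.≤-antisym (c↓ i) (ℕ.≮⇒≥ ≮)) ci≡)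
      in i′ , ℕ.<⇒≤ i<i′ , eq

-- A plane partition read column by column: `c j i` is the entry of column `j` in row `i`. `J` is
-- any bound on the nonzero columns, so that two partitions can share one.
record Columns (n J : ℕ) (c : ℕ → ℕ → ℕ) : Set where
  field
    rows  : ∀ j i → c j (suc i) ≤ c j i
    cols  : ∀ j i → c (suc j) i ≤ c j i
    below : ∀ j i → n ≤ i → c j i ≡ 0
    right : ∀ j i → J ≤ j → c j i ≡ 0

tail : ∀ {n J c} → Columns n J c → Columns n J (c ∘ suc)
tail C = record
  { rows = Columns.rows C ∘ suc ; cols = Columns.cols C ∘ suc ; below = Columns.below C ∘ suc
  ; right = λ j i J≤j → Columns.right C (suc j) i (ℕ.m≤n⇒m≤1+n J≤j) }

antitone : (f : ℕ → ℕ) → (∀ i → f (suc i) ≤ f i) → ∀ {i i′} → i ≤ i′ → f i′ ≤ f i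
antitone f f↓ {i′ = zero}   z≤n = ℕ.≤-refl
antitone f f↓ {i′ = suc i′} z≤n = ℕ.≤-trans (f↓ i′) (antitone f f↓ {i′ = i′} z≤n)
antitone f f↓ (s≤s i≤i′)        = antitone (f ∘ suc) (f↓ ∘ suc) i≤i′

corners : ℕ → (ℕ → ℕ → ℕ) → ℕ → ℕ → ℕ
corners J c i ℓ = ∑< J (λ j → corner (c j) i ℓ)

-- Column `J` is zero and has no corners; appending it lets the tail keep the same bound `J`.
corners-uncons : ∀ {n J c} → Columns n J c → ∀ i ℓ →
                 corners J c i ℓ ≡ corner (c 0) i ℓ + corners J (c ∘ suc) i ℓ
corners-uncons {J = J} {c} C i ℓ = begin
  corners J c i ℓ
    ≡⟨ ℕ.+-identityʳ _ ⟨
  corners J c i ℓ + 0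
    ≡⟨ cong (corners J c i ℓ +_) (corner-zero {c J} (Columns.right C J i ℕ.≤-refl)) ⟨
  corners (suc J) c i ℓ
    ≡⟨ ∑<-front J (λ j → corner (c j) i ℓ) ⟩
  corner (c 0) i ℓ + corners J (c ∘ suc) i ℓ ∎
  where open ≡-Reasoning

module _ {n J c c′} (C : Columns n J c) (C′ : Columns n J c′) where

  -- The value of `c 0` in row `i` is attained at a corner in some row `i′` at or below `i`. Equal
  -- counts make this a corner of some column of `c′`, which lies inside `c′ 0`.
  first-≤ : (∀ i ℓ → corners J c i ℓ ≡ corners J c′ i ℓ) → ∀ i → c 0 i ≤ c′ 0 i
  first-≤ eq i with c 0 i in c0i≡
  ... | zero  = z≤n
  ... | suc ℓ =
    let (i′ , i≤i′ , corner≡1) = corner-below (Columns.rows C 0) (Columns.below C 0) c0i≡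
        0<J : 0 < J
        0<J = ℕ.≰⇒> (λ J≤0 → ℕ.0≢1+n (trans (sym (Columns.right C 0 i J≤0)) c0i≡))
        0<corners : 0 < corners J c i′ ℓ
        0<corners = ℕ.≤-trans (ℕ.≤-reflexive (sym corner≡1)) (term≤∑< (λ j → corner (c j) i′ ℓ) 0<J)
        (j , _ , corner≢) = ∑<≢0 J (λ j → corner (c′ j) i′ ℓ)
                              (ℕ.m<n⇒n≢0 (subst (0 <_) (eq i′ ℓ) 0<corners))
        (c′ji′≡ , _) = corner≢0 {c′ j} corner≢
    in begin
      suc ℓ    ≡⟨ c′ji′≡ ⟨
      c′ j i′  ≤⟨ antitone (λ j → c′ j i′) (λ j → Columns.cols C′ j i′) z≤n ⟩
      c′ 0 i′  ≤⟨ antitone (c′ 0) (Columns.rows C′ 0) i≤i′ ⟩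
      c′ 0 i   ∎
    where open ℕ.≤-Reasoning

-- Both inequalities of `first-≤` identify the first columns. Their corners then cancel from the
-- counts, which leaves the same hypothesis for the tails.
corners-injective : ∀ {n J c c′} → Columns n J c → Columns n J c′ →
                    (∀ i ℓ → corners J c i ℓ ≡ corners J c′ i ℓ) → ∀ j i → c j i ≡ c′ j i
corners-injective {J = J} {c} {c′} C C′ eq = λ
  { zero    → first
  ; (suc j) → corners-injective (tail C) (tail C′) rest j
  }
  where
  first : ∀ i → c 0 i ≡ c′ 0 i
  first i = ℕ.≤-antisym (first-≤ C C′ eq i) (first-≤ C′ C (λ i ℓ → sym (eq i ℓ)) i)
  rest : ∀ i ℓ → corners J (c ∘ suc) i ℓ ≡ corners J (c′ ∘ suc) i ℓ
  rest i ℓ = ℕ.+-cancelˡ-≡ (corner (c 0) i ℓ) _ _ (begin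
    corner (c 0) i ℓ + corners J (c ∘ suc) i ℓ
      ≡⟨ corners-uncons C i ℓ ⟨
    corners J c i ℓ
      ≡⟨ eq i ℓ ⟩
    corners J c′ i ℓ
      ≡⟨ corners-uncons C′ i ℓ ⟩
    corner (c′ 0) i ℓ + corners J (c′ ∘ suc) i ℓ
      ≡⟨ cong (_+ _) (cong₂ (λ x y → iverson (drop? x y ℓ)) (first i) (first (suc i))) ⟨
    corner (c 0) i ℓ + corners J (c′ ∘ suc) i ℓ ∎)
    where open ≡-Reasoning

-- Reconstruction from corners

-- One more than the largest index in the support of `r` below `m`: already a column value, with 0
-- for an empty support.
highest : ℕ → (ℕ → ℕ) → ℕ
highest zero    r = 0
highest (suc m) r with r m ℕ.≟ 0
... | yes _ = highest m r
... | no  _ = suc m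

highest-≤ : ∀ m r → highest m r ≤ m
highest-≤ zero    r = z≤n
highest-≤ (suc m) r with r m ℕ.≟ 0
... | yes _ = ℕ.m≤n⇒m≤1+n (highest-≤ m r)
... | no  _ = ℕ.≤-refl

highest-above : ∀ {m ℓ} r → ℓ < m → r ℓ ≢ 0 → ℓ < highest m r
highest-above {suc m} {ℓ} r ℓ<1+m rℓ≢0 with r m ℕ.≟ 0
... | no  _    = ℓ<1+m
... | yes rm≡0 = highest-above r (ℕ.≤∧≢⇒< (ℕ.≤-pred ℓ<1+m) (λ { refl → rℓ≢0 rm≡0 })) rℓ≢0

highest-attained : ∀ m {ℓ} r → highest m r ≡ suc ℓ → r ℓ ≢ 0
highest-attained (suc m) r eq with r m ℕ.≟ 0
... | yes _    = highest-attained m r eq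
... | no  rm≢0 with refl ← eq = rm≢0

module _ (n m : ℕ) where

  Boxed : (ℕ → ℕ → ℕ) → Set
  Boxed D = ∀ i ℓ → D i ℓ ≢ 0 → i < n × ℓ < m

  -- The column whose diagram is the order ideal generated by the support of D.
  hull : (ℕ → ℕ → ℕ) → ℕ → ℕ
  hull D i = highest m (λ ℓ → ∑< n (λ k → D (i + k) ℓ))

  -- Since `D` is boxed, `i′` is below `n`, so the offset `i′ ∸ i` is among the `n` offsets summed
  -- in `hull`.
  hull-above : ∀ {D i i′ ℓ} → Boxed D → i ≤ i′ → D i′ ℓ ≢ 0 → ℓ < hull D i
  hull-above {D} {i} {i′} {ℓ} box i≤i′ D≢0 =
    let (i′<n , ℓ<m) = box i′ ℓ D≢0
        D≤∑ = term≤∑< (λ k → D (i + k) ℓ) (ℕ.≤-<-trans (ℕ.m∸n≤m i′ i) i′<n)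
    in highest-above _ ℓ<m (λ ∑≡0 → D≢0 (ℕ.n≤0⇒n≡0 (subst₂ _≤_
         (cong (λ i → D i ℓ) (ℕ.m+[n∸m]≡n i≤i′)) ∑≡0 D≤∑)))

  hull-attained : ∀ {D i ℓ} → hull D i ≡ suc ℓ → ∃[ i′ ] i ≤ i′ × D i′ ℓ ≢ 0
  hull-attained {D} {i} {ℓ} eq =
    let (k , _ , D≢0) = ∑<≢0 n _ (highest-attained m _ eq) in i + k , ℕ.m≤m+n i k , D≢0

  -- Used in two ways: with `D` equal to `E` it makes a hull weakly decreasing down the rows; with
  -- `i` equal to `i′` it makes successive hulls nested.
  hull-mono : ∀ {D E i i′} → Boxed E → (∀ i ℓ → D i ℓ ≢ 0 → E i ℓ ≢ 0) → i ≤ i′ →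
              hull D i′ ≤ hull E i
  hull-mono {D} {E} {i} {i′} box D⊆E i≤i′ with hull D i′ in eq
  ... | zero  = z≤n
  ... | suc ℓ = let (i″ , i′≤i″ , D≢0) = hull-attained {D} eq in
                hull-above box (ℕ.≤-trans i≤i′ i′≤i″) (D⊆E i″ ℓ D≢0)

  hull-↓ : ∀ {D} → Boxed D → ∀ i → hull D (suc i) ≤ hull D i
  hull-↓ {D} box i = hull-mono {D} box (λ _ _ → id) (ℕ.n≤1+n i)

  hull-below : ∀ {D} → Boxed D → ∀ i → n ≤ i → hull D i ≡ 0
  hull-below {D} box i n≤i with hull D i in eq
  ... | zero  = refl
  ... | suc ℓ = let (i′ , i≤i′ , D≢0) = hull-attained {D} eq in
    ⊥-elim (ℕ.<⇒≱ (proj₁ (box i′ ℓ D≢0)) (ℕ.≤-trans n≤i i≤i′))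

  -- The value of the hull at a corner comes from a nonzero entry in some row `i′` at or below `i`.
  -- If `i′` were beyond `i`, the hull would not drop after row `i`; so the entry sits at the
  -- corner. Hence the truncated subtraction in `peel` is exact.
  hull-corner-≤ : ∀ {D} → Boxed D → ∀ i ℓ → corner (hull D) i ℓ ≤ D i ℓ
  hull-corner-≤ {D} box i ℓ = iverson-≤ (drop? (hull D i) (hull D (suc i)) ℓ) (λ (eq , lt) →
    let (i′ , i≤i′ , D≢0) = hull-attained {D} eq
        i′≤i = ℕ.≮⇒≥ (λ i<i′ → ℕ.<⇒≱ (hull-above box i<i′ D≢0)
                 (ℕ.≤-pred (subst (hull D (suc i) <_) eq lt)))
    in ℕ.n≢0⇒n>0 (subst (λ i → D i ℓ ≢ 0) (ℕ.≤-antisym i′≤i i≤i′) D≢0))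

  peel : (ℕ → ℕ → ℕ) → ℕ → ℕ → ℕ
  peel D i ℓ = D i ℓ ∸ corner (hull D) i ℓ

  peel-⊆ : ∀ D i ℓ → peel D i ℓ ≢ 0 → D i ℓ ≢ 0
  peel-⊆ D i ℓ ≢0 D≡0 = ≢0 (ℕ.n≤0⇒n≡0 (subst (peel D i ℓ ≤_) D≡0
    (ℕ.m∸n≤m (D i ℓ) (corner (hull D) i ℓ))))

  peels : ℕ → (ℕ → ℕ → ℕ) → ℕ → ℕ → ℕ
  peels zero    D = D
  peels (suc j) D = peel (peels j D)

  peels-boxed : ∀ {D} → Boxed D → ∀ j → Boxed (peels j D)
  peels-boxed     box zero           = box
  peels-boxed {D} box (suc j) i ℓ ≢0 = peels-boxed box j i ℓ (peel-⊆ (peels j D) i ℓ ≢0)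

  corner+peel : ∀ {D} → Boxed D → ∀ i ℓ → corner (hull D) i ℓ + peel D i ℓ ≡ D i ℓ
  corner+peel box i ℓ = ℕ.m+[n∸m]≡n (hull-corner-≤ box i ℓ)

  -- The measure that decreases under peeling, and therefore also a bound on the number of columns
  -- of the reconstructed partition.
  size : (ℕ → ℕ → ℕ) → ℕ
  size D = ∑< n (λ i → ∑< m (D i))

  entry≤size : ∀ {D} → Boxed D → ∀ i ℓ → D i ℓ ≤ size D
  entry≤size {D} box i ℓ with D i ℓ ℕ.≟ 0
  ... | yes D≡0 = subst (_≤ size D) (sym D≡0) z≤n
  ... | no  D≢0 = let (i<n , ℓ<m) = box i ℓ D≢0 in
    ℕ.≤-trans (term≤∑< (D i) ℓ<m) (term≤∑< (λ i → ∑< m (D i)) i<n)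

  size-corner+peel : ∀ {D} → Boxed D → size (corner (hull D)) + size (peel D) ≡ size D
  size-corner+peel {D} box = sym (trans
    (∑<-cong n (λ {i} _ → trans (∑<-cong m (λ {ℓ} _ → sym (corner+peel box i ℓ)))
                            (∑<-+ m (corner (hull D) i) (peel D i))))
    (∑<-+ n (λ i → ∑< m (corner (hull D) i)) (λ i → ∑< m (peel D i))))

  hull-corner : ∀ {D} → Boxed D → size D ≢ 0 → size (corner (hull D)) ≢ 0
  hull-corner {D} box size≢0 with ∑<≢0 n _ size≢0
  ... | i , _ , ∑≢0 with ∑<≢0 m _ ∑≢0
  -- A nonzero entry makes the hull positive in row 0, which excludes the case `zero`;
  -- `corner-below` then finds a corner.
  ...   | ℓ , _ , D≢0 with hull D 0 in eq | hull-above {i = 0} box z≤n D≢0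
  ...     | suc ℓ′ | _ =
    let (i′ , _ , corner≡1) = corner-below (hull-↓ box) (hull-below box) eq
        corner-boxed : Boxed (corner (hull D))
        corner-boxed i ℓ c≢0 = box i ℓ (λ D≡0 →
          c≢0 (ℕ.n≤0⇒n≡0 (subst (corner (hull D) i ℓ ≤_) D≡0 (hull-corner-≤ box i ℓ))))
    in ℕ.m<n⇒n≢0 (subst (_≤ size (corner (hull D))) corner≡1 (entry≤size corner-boxed i′ ℓ′))

  -- A nonzero matrix has a hull with at least one corner to remove; for the zero matrix the
  -- truncated subtraction gives 0.
  size-peel : ∀ {D} → Boxed D → size (peel D) ≤ size D ∸ 1
  size-peel {D} box with size (corner (hull D)) in eq
  ... | suc k = ℕ.≤-trans (ℕ.m≤n+m _ k) (ℕ.≤-reflexive (cong (_∸ 1)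
                  (trans (cong (_+ size (peel D)) (sym eq)) (size-corner+peel box))))
  ... | zero with size D ℕ.≟ 0
  ...   | no  size≢0 = ⊥-elim (hull-corner box size≢0 eq)
  ...   | yes size≡0 = ℕ.≤-trans (ℕ.m≤n+m _ (size (corner (hull D))))
                         (subst (_≤ size D ∸ 1) (sym (trans (size-corner+peel box) size≡0)) z≤n)

  size-peels : ∀ {D} → Boxed D → ∀ j → size (peels j D) ≤ size D ∸ j
  size-peels box zero    = ℕ.≤-refl
  size-peels {D} box (suc j) = begin
    size (peel (peels j D))   ≤⟨ size-peel (peels-boxed box j) ⟩
    size (peels j D) ∸ 1      ≤⟨ ℕ.∸-monoˡ-≤ 1 (size-peels box j) ⟩
    size D ∸ j ∸ 1            ≡⟨ ℕ.∸-+-assoc (size D) j 1 ⟩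
    size D ∸ (j + 1)          ≡⟨ cong (size D ∸_) (ℕ.+-comm j 1) ⟩
    size D ∸ suc j            ∎
    where open ℕ.≤-Reasoning

  peels-vanish : ∀ {D} → Boxed D → ∀ {j} → size D ≤ j → ∀ i ℓ → peels j D i ℓ ≡ 0
  peels-vanish {D} box {j} size≤j i ℓ = ℕ.n≤0⇒n≡0 (begin
    peels j D i ℓ     ≤⟨ entry≤size (peels-boxed box j) i ℓ ⟩
    size (peels j D)  ≤⟨ size-peels box j ⟩
    size D ∸ j        ≡⟨ ℕ.m≤n⇒m∸n≡0 size≤j ⟩
    0                 ∎)
    where open ℕ.≤-Reasoning

  hulls : (ℕ → ℕ → ℕ) → ℕ → ℕ → ℕ
  hulls D j = hull (peels j D)

  hulls-columns : ∀ {D} → Boxed D → Columns n (size D) (hulls D)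
  hulls-columns {D} box = record
    { rows  = λ j → hull-↓ (peels-boxed box j)
    ; cols  = λ j i →
        hull-mono {peels (suc j) D} {i = i} (peels-boxed box j) (peel-⊆ (peels j D)) ℕ.≤-refl
    ; below = λ j → hull-below (peels-boxed box j)
    ; right = right′
    }
    where
    right′ : ∀ j i → size D ≤ j → hulls D j i ≡ 0
    right′ j i size≤j with hulls D j i in eq
    ... | zero  = refl
    ... | suc ℓ = let (i′ , _ , ≢0) = hull-attained {peels j D} eq in
                  ⊥-elim (≢0 (peels-vanish box size≤j i′ ℓ))

  -- The invariant of peeling: each step moves the corners of the current hull from the remainder to
  -- the count. After `size D` steps the remainder is zero.
  corners+peels : ∀ {D} → Boxed D → ∀ j i ℓ → corners j (hulls D) i ℓ + peels j D i ℓ ≡ D i ℓ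
  corners+peels box zero    i ℓ = refl
  corners+peels {D} box (suc j) i ℓ = begin
    corners j (hulls D) i ℓ + corner (hulls D j) i ℓ + peels (suc j) D i ℓ
      ≡⟨ ℕ.+-assoc (corners j (hulls D) i ℓ) _ _ ⟩
    corners j (hulls D) i ℓ + (corner (hulls D j) i ℓ + peels (suc j) D i ℓ)
      ≡⟨ cong (corners j (hulls D) i ℓ +_) (corner+peel (peels-boxed box j) i ℓ) ⟩
    corners j (hulls D) i ℓ + peels j D i ℓ
      ≡⟨ corners+peels box j i ℓ ⟩
    D i ℓ ∎
    where open ≡-Reasoning

  corners-hulls : ∀ {D} → Boxed D → ∀ {J} → size D ≤ J → ∀ i ℓ → corners J (hulls D) i ℓ ≡ D i ℓ
  corners-hulls {D} box {J} size≤J i ℓ = trans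
    (sym (trans (cong (corners J (hulls D) i ℓ +_) (peels-vanish box size≤J i ℓ))
      (ℕ.+-identityʳ _)))
    (corners+peels box J i ℓ)

-- Vectors indexed by ℕ

-- Counted from the end, so that `at z xs k` is the component weighted by d (suc k) in `total d xs`.
at : ∀ {A : Set} {n} → A → Vec A n → ℕ → A
at z []                 k = z
at z (_∷_ {n = n} x xs) k with k ℕ.≟ n
... | yes _ = x
... | no  _ = at z xs k

at-last : ∀ {A : Set} {n} z (x : A) (xs : Vec A n) → at z (x ∷ xs) n ≡ x
at-last {n = n} z x xs with n ℕ.≟ n
... | yes _  = refl
... | no n≢n = ⊥-elim (n≢n refl)

at-init : ∀ {A : Set} {n k} z (x : A) (xs : Vec A n) → k ≢ n → at z (x ∷ xs) k ≡ at z xs k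
at-init {n = n} {k} z x xs k≢n with k ℕ.≟ n
... | yes k≡n = ⊥-elim (k≢n k≡n)
... | no _    = refl

at-outside : ∀ {A : Set} {n k} z (xs : Vec A n) → n ≤ k → at z xs k ≡ z
at-outside z []       n≤k = refl
at-outside z (x ∷ xs) n<k = trans (at-init z x xs (ℕ.>⇒≢ n<k)) (at-outside z xs (ℕ.<⇒≤ n<k))

at-ext : ∀ {A : Set} {n} z (xs ys : Vec A n) → (∀ k → at z xs k ≡ at z ys k) → xs ≡ ys
at-ext z []       []       eq = refl
at-ext {n = suc n} z (x ∷ xs) (y ∷ ys) eq =
  cong₂ _∷_ (trans (sym (at-last z x xs)) (trans (eq n) (at-last z y ys)))
    (at-ext z xs ys eq′)
  where
  eq′ : ∀ k → at z xs k ≡ at z ys k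
  eq′ k with k ℕ.≟ n
  ... | yes refl = trans (at-outside z xs ℕ.≤-refl) (sym (at-outside z ys ℕ.≤-refl))
  ... | no k≢n   = trans (sym (at-init z x xs k≢n)) (trans (eq k) (at-init z y ys k≢n))

fromFun : ∀ {A : Set} n → (ℕ → A) → Vec A n
fromFun zero    f = []
fromFun (suc n) f = f n ∷ fromFun n f

at-fromFun : ∀ {A : Set} {n k} z (f : ℕ → A) → k < n → at z (fromFun n f) k ≡ f k
at-fromFun {n = suc n} z f k<1+n with ℕ.m≤n⇒m<n∨m≡n (ℕ.≤-pred k<1+n)
... | inj₁ k<n  = trans (at-init z (f n) (fromFun n f) (ℕ.<⇒≢ k<n)) (at-fromFun z f k<n)
... | inj₂ refl = at-last z (f n) (fromFun n f)

total-at : ∀ {A : Set} {n} z (d : ℕ → A → ℕ) (xs : Vec A n) →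
           total d xs ≡ ∑< n (λ k → d (suc k) (at z xs k))
total-at z d []                 = refl
total-at z d (_∷_ {n = n} x xs) = cong₂ _+_
  (trans (total-at z d xs) (∑<-cong n (λ k<n →
    cong (d _) (sym (at-init z x xs (ℕ.<⇒≢ k<n))))))
  (cong (d (suc n)) (sym (at-last z x xs)))

module _ {n m : ℕ} where

  zeros : Vec ℕ n
  zeros = fromFun n (const 0)

  -- The outer vector runs over values and the inner one over rows, in the order of the double
  -- product, so the arguments are swapped here. Outside the box the entry is 0.
  matrix : Vec (Vec ℕ n) m → ℕ → ℕ → ℕ
  matrix x i ℓ = at 0 (at zeros x ℓ) i

  at-zeros : ∀ i → at 0 zeros i ≡ 0
  at-zeros i with i ℕ.<? n
  ... | yes i<n = at-fromFun 0 (const 0) i<n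
  ... | no  i≮n = at-outside 0 zeros (ℕ.≮⇒≥ i≮n)

  matrix-boxed : ∀ x → Boxed n m (matrix x)
  matrix-boxed x i ℓ ≢0 =
    ℕ.≰⇒> (λ n≤i → ≢0 (at-outside 0 (at zeros x ℓ) n≤i)) ,
    ℕ.≰⇒> (λ m≤ℓ → ≢0 (trans (cong (λ r → at 0 r i) (at-outside zeros x m≤ℓ)) (at-zeros i)))

  matrix-injective : ∀ x y → (∀ i ℓ → matrix x i ℓ ≡ matrix y i ℓ) → x ≡ y
  matrix-injective x y eq = at-ext zeros x y (λ ℓ →
    at-ext 0 (at zeros x ℓ) (at zeros y ℓ) (λ i → eq i ℓ))

  fromMatrix : (ℕ → ℕ → ℕ) → Vec (Vec ℕ n) m
  fromMatrix D = fromFun m (λ ℓ → fromFun n (λ i → D i ℓ))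

  matrix-fromMatrix : ∀ {D} → Boxed n m D → ∀ i ℓ → matrix (fromMatrix D) i ℓ ≡ D i ℓ
  matrix-fromMatrix {D} box i ℓ with (i ℕ.<? n) ×-dec (ℓ ℕ.<? m)
  ... | yes (i<n , ℓ<m) = trans (cong (λ r → at 0 r i) (at-fromFun zeros _ ℓ<m))
                            (at-fromFun 0 (λ i → D i ℓ) i<n)
  ... | no outside      = trans (vanish (matrix-boxed (fromMatrix D))) (sym (vanish box))
    where
    vanish : ∀ {E} → Boxed n m E → E i ℓ ≡ 0
    vanish {E} box with E i ℓ ℕ.≟ 0
    ... | yes E≡0 = E≡0
    ... | no  E≢0 = ⊥-elim (outside (box i ℓ E≢0))

  total-matrix : (d : ℕ → ℕ → ℕ → ℕ) (x : Vec (Vec ℕ n) m) →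
    total (λ i → total (d i)) x ≡ ∑< m (λ ℓ → ∑< n (λ i → d (suc ℓ) (suc i) (matrix x i ℓ)))
  total-matrix d x = trans (total-at zeros (λ i → total (d i)) x)
    (∑<-cong m (λ {ℓ} _ → total-at 0 (d (suc ℓ)) (at zeros x ℓ)))

-- Sums over descents

sum-filter : ∀ {A : Set} {P : Pred A _} (P? : Decidable P) g xs →
             sum (map g (filter P? xs)) ≡ sum (map (λ x → iverson (P? x) ℕ.* g x) xs)
sum-filter P? g []       = refl
sum-filter P? g (x ∷ xs) with P? x
... | yes _ = cong₂ _+_ (sym (ℕ.+-identityʳ (g x))) (sum-filter P? g xs)
... | no  _ = sum-filter P? g xs

sum-applyUpTo : ∀ n f → sum (applyUpTo f n) ≡ ∑< n f
sum-applyUpTo zero    f = refl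
sum-applyUpTo (suc n) f = trans (cong (f 0 +_) (sum-applyUpTo n (f ∘ suc))) (sym (∑<-front n f))

sum-upTo : ∀ n f → sum (map f (upTo n)) ≡ ∑< n f
sum-upTo n f = trans (cong sum (map-upTo f n)) (sum-applyUpTo n f)

sum-cartesianProduct : ∀ {A B : Set} (h : A × B → ℕ) xs ys →
  sum (map h (cartesianProduct xs ys)) ≡ sum (map (λ x → sum (map (λ y → h (x , y)) ys)) xs)
sum-cartesianProduct h []       ys = refl
sum-cartesianProduct h (x ∷ xs) ys = begin
  sum (map h (map (x ,_) ys ++ cartesianProduct xs ys))
    ≡⟨ cong sum (map-++ h (map (x ,_) ys) _) ⟩
  sum (map h (map (x ,_) ys) ++ map h (cartesianProduct xs ys))
    ≡⟨ sum-++ (map h (map (x ,_) ys)) _ ⟩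
  sum (map h (map (x ,_) ys)) + sum (map h (cartesianProduct xs ys))
    ≡⟨ cong₂ _+_ (cong sum (sym (map-∘ ys))) (sum-cartesianProduct h xs ys) ⟩
  _ ∎
  where open ≡-Reasoning

-- A nonzero `x` is `suc ℓ` for exactly one `ℓ`, and the bound `m` on the entries puts that `ℓ` in
-- range. For `x` equal to 0 both sides vanish.
drop-sum : ∀ {m} (f : ℕ → ℕ) x y → x ≤ m →
           iverson (y ℕ.<? x) ℕ.* f x ≡ ∑< m (λ ℓ → iverson (drop? x y ℓ) ℕ.* f (suc ℓ))
drop-sum {m} f zero    y _ = sym (∑<-zero m)
drop-sum {m} f (suc v) y v<m = sym (trans
  (∑<-single (λ ℓ → iverson (drop? (suc v) y ℓ) ℕ.* f (suc ℓ)) v<m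
    (λ ℓ ℓ≢v → cong (ℕ._* f (suc ℓ)) (iverson-false (drop? (suc v) y ℓ)
      (λ (eq , _) → ℓ≢v (sym (ℕ.suc-injective eq))))))
  (cong (ℕ._* f (suc v)) (iverson-cong (drop? (suc v) y v) (y ℕ.<? suc v) proj₂ (refl ,_))))

module _ {n m J : ℕ} (π : PlanePartition) (C : Columns n J (flip (entry π)))
         (π≤m : EntriesAtMost m π) where

  open Columns C

  private
    c = flip (entry π)
    cells = cartesianProduct (upTo n) (upTo J)

  -- The list in `finite` is arbitrary. Descents have nonzero entries, so they all lie in the `n` by
  -- `J` rectangle, over which sums can be interchanged.
  descents-↭-cells : descents π ↭ filter (Des? π) cells
  descents-↭-cells = ∼bag⇒↭ (unique∧set⇒bag (descents-unique π)
    (Unique.filter⁺ (Des? π) (Unique.cartesianProduct⁺ (Unique.upTo⁺ n) (Unique.upTo⁺ J)))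
    (λ {cell} → mk⇔
      (λ ∈d → let des = Equivalence.to (∈-descents π cell) ∈d in
              ∈-filter⁺ (Des? π) (inside des) des)
      (λ ∈f → Equivalence.from (∈-descents π cell) (proj₂ (∈-filter⁻ (Des? π) {xs = cells} ∈f)))))
    where
    inside : ∀ {cell} → Des π cell → cell ∈ cells
    inside {i , j} des = ∈-cartesianProduct⁺
      (∈-upTo⁺ (ℕ.≰⇒> (ℕ.m<n⇒n≢0 des ∘ below j i)))
      (∈-upTo⁺ (ℕ.≰⇒> (ℕ.m<n⇒n≢0 des ∘ right j i)))

  -- A general weight covers both statistics: the constant 1 gives `des`, value plus row index gives
  -- the up-hook volume. Interchanging sums groups the descents by value and row.
  sum-descents : (w : ℕ → ℕ → ℕ) →
    sum (map (λ (i , j) → w i (entry π i j)) (descents π)) ≡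
    ∑< m (λ ℓ → ∑< n (λ i → corners J c i ℓ ℕ.* w i (suc ℓ)))
  sum-descents w = begin
    sum (map g (descents π))
      ≡⟨ sum-↭ (map⁺ g descents-↭-cells) ⟩
    sum (map g (filter (Des? π) cells))
      ≡⟨ sum-filter (Des? π) g cells ⟩
    sum (map h cells)
      ≡⟨ sum-cartesianProduct h (upTo n) (upTo J) ⟩
    sum (map (λ i → sum (map (λ j → h (i , j)) (upTo J))) (upTo n))
      ≡⟨ sum-upTo n _ ⟩
    ∑< n (λ i → sum (map (λ j → h (i , j)) (upTo J)))
      ≡⟨ ∑<-cong n (λ {i} _ → sum-upTo J _) ⟩
    ∑< n (λ i → ∑< J (λ j → h (i , j)))
      ≡⟨ ∑<-cong n (λ {i} _ → ∑<-cong J (λ {j} _ →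
           drop-sum (w i) (c j i) (c j (suc i)) (π≤m i j))) ⟩
    ∑< n (λ i → ∑< J (λ j → ∑< m (λ ℓ → corner (c j) i ℓ ℕ.* w i (suc ℓ))))
      ≡⟨ ∑<-cong n (λ _ → ∑<-comm J m _) ⟩
    ∑< n (λ i → ∑< m (λ ℓ → ∑< J (λ j → corner (c j) i ℓ ℕ.* w i (suc ℓ))))
      ≡⟨ ∑<-comm n m _ ⟩
    ∑< m (λ ℓ → ∑< n (λ i → ∑< J (λ j → corner (c j) i ℓ ℕ.* w i (suc ℓ))))
      ≡⟨ ∑<-cong m (λ {ℓ} _ → ∑<-cong n (λ {i} _ →
           ∑<-*ʳ J (λ j → corner (c j) i ℓ) (w i (suc ℓ)))) ⟨
    ∑< m (λ ℓ → ∑< n (λ i → corners J c i ℓ ℕ.* w i (suc ℓ))) ∎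
    where
    open ≡-Reasoning
    g h : ℕ × ℕ → ℕ
    g (i , j) = w i (entry π i j)
    h cell = iverson (Des? π cell) ℕ.* g cell

-- Plane partitions

unique-bounded⇒length≤ : ∀ {n} {xs : List ℕ} → Unique xs → All (_< n) xs → length xs ≤ n
unique-bounded⇒length≤ {n} {xs} xs! xs<n = begin
  length xs                          ≡⟨ ↭-length xs↭ ⟩
  length (filter (_∈? xs) (upTo n))  ≤⟨ length-filter (_∈? xs) (upTo n) ⟩
  length (upTo n)                    ≡⟨ length-upTo n ⟩
  n                                  ∎
  where
  open ℕ.≤-Reasoning
  xs↭ : xs ↭ filter (_∈? xs) (upTo n)
  xs↭ = ∼bag⇒↭ (unique∧set⇒bag xs! (Unique.filter⁺ (_∈? xs) (Unique.upTo⁺ n))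
    (mk⇔ (λ x∈ → ∈-filter⁺ (_∈? xs) (∈-upTo⁺ (All.lookup xs<n x∈)) x∈)
         (proj₂ ∘ ∈-filter⁻ (_∈? xs) {xs = upTo n})))

weaken : ∀ {n J J′ c} → J ≤ J′ → Columns n J c → Columns n J′ c
weaken J≤J′ C = record
  { rows = rows ; cols = cols ; below = below
  ; right = λ j i J′≤j → right j i (ℕ.≤-trans J≤J′ J′≤j) }
  where open Columns C

corners-weaken : ∀ {n J c} → Columns n J c → ∀ k i ℓ → corners (k + J) c i ℓ ≡ corners J c i ℓ
corners-weaken C zero    i ℓ = refl
corners-weaken {J = J} {c} C (suc k) i ℓ = trans
  (cong₂ _+_ (corners-weaken C k i ℓ)
    (corner-zero {c (k + J)} (Columns.right C (k + J) i (ℕ.m≤n+m J k))))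
  (ℕ.+-identityʳ _)

corners-cong : ∀ {c c′} → (∀ j i → c j i ≡ c′ j i) → ∀ J i ℓ → corners J c i ℓ ≡ corners J c′ i ℓ
corners-cong eq J i ℓ = ∑<-cong J (λ {j} _ →
  cong₂ (λ x y → iverson (drop? x y ℓ)) (eq j i) (eq j (suc i)))

corners-boxed : ∀ {n m J c} → Columns n J c → (∀ j i → c j i ≤ m) → Boxed n m (corners J c)
corners-boxed {m = m} {J} {c} C c≤m i ℓ ≢0 =
  let (j , _ , corner≢0′) = ∑<≢0 J (λ j → corner (c j) i ℓ) ≢0
      (cji≡ , _) = corner≢0 {c j} corner≢0′
  in ℕ.≰⇒> (λ n≤i → ℕ.0≢1+n (trans (sym (Columns.below C j i n≤i)) cji≡)) ,
     subst (_≤ m) cji≡ (c≤m j i)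

module _ (n m : ℕ) where

  open Setoid (PP∞ n m) using (Carrier) renaming (_≈_ to _≋_)

  columns : ((π , _) : Carrier) → ∃[ J ] Columns n J (flip (entry π))
  columns (π , rows≤n , _) = suc (max 0 (map proj₂ cells)) , record
    { rows  = flip (row-decreasing π)
    ; cols  = flip (col-decreasing π)
    ; below = below
    ; right = right
    }
    where
    cells = proj₁ (finite π)
    below : ∀ j i → n ≤ i → entry π i j ≡ 0
    below j i n≤i with entry π i j ℕ.≟ 0
    ... | yes ≡0 = ≡0
    -- A nonzero entry in row `i` makes the rows 0 to `i` all nonzero in column `j`: at least
    -- `n + 1` distinct rows.
    ... | no  ≢0 = ⊥-elim (ℕ.<⇒≱ (s≤s n≤i) (subst (_≤ n) (length-upTo (suc i))
      (rows≤n (upTo (suc i)) (Unique.upTo⁺ (suc i)) (All.tabulate (λ {i′} i′∈ → j , λ ≡0 →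
        ≢0 (ℕ.n≤0⇒n≡0 (subst (entry π i j ≤_) ≡0
          (antitone (λ i → entry π i j) (λ i → row-decreasing π i j)
            (ℕ.≤-pred (∈-upTo⁻ i′∈))))))))))
    right : ∀ j i → suc (max 0 (map proj₂ cells)) ≤ j → entry π i j ≡ 0
    right j i <j with entry π i j ℕ.≟ 0
    ... | yes ≡0 = ≡0
    ... | no  ≢0 = ⊥-elim (ℕ.<⇒≱ <j (All.lookup (xs≤max 0 (map proj₂ cells))
                     (∈-map⁺ proj₂ (proj₂ (finite π) i j ≢0))))

  -- The bijection between matrices and plane partitions.

  Matrix = Vec (Vec ℕ n) m

  partition : Matrix → PlanePartition
  partition x = record
    { entry          = λ i j → hulls n m (matrix x) j i
    ; row-decreasing = λ i j → rows j i
    ; col-decreasing = λ i j → cols j i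
    ; finite         = cartesianProduct (upTo n) (upTo (size n m (matrix x))) , λ i j ≢0 →
        ∈-cartesianProduct⁺ (∈-upTo⁺ (ℕ.≰⇒> (≢0 ∘ below j i))) (∈-upTo⁺ (ℕ.≰⇒> (≢0 ∘ right j i)))
    }
    where open Columns (hulls-columns n m (matrix-boxed x))

  toPP : Matrix → Carrier
  toPP x = partition x
    , (λ is is! nonzero → unique-bounded⇒length≤ is! (All.map
        (λ {i} (j , ≢0) → ℕ.≰⇒> (≢0 ∘ Columns.below (hulls-columns n m (matrix-boxed x)) j i))
        nonzero))
    , (λ i j → highest-≤ m _)

  -- The matrix can be read off as the corner counts of its partition, which depend on the entries
  -- alone. The sum of the two sizes bounds the columns of both.
  toPP-injective : ∀ {x y} → toPP x ≋ toPP y → x ≡ y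
  toPP-injective {x} {y} eq = matrix-injective x y (λ i ℓ → begin
    matrix x i ℓ
      ≡⟨ corners-hulls n m (matrix-boxed x) (ℕ.m≤m+n _ (size n m (matrix y))) i ℓ ⟨
    corners J (hulls n m (matrix x)) i ℓ
      ≡⟨ corners-cong (λ j i → eq i j) J i ℓ ⟩
    corners J (hulls n m (matrix y)) i ℓ
      ≡⟨ corners-hulls n m (matrix-boxed y) (ℕ.m≤n+m _ (size n m (matrix x))) i ℓ ⟩
    matrix y i ℓ ∎)
    where
    open ≡-Reasoning
    J = size n m (matrix x) + size n m (matrix y)

  -- Take for `x` the corner counts of `π`. The hulls of `x` have the same counts, so
  -- `corners-injective` identifies them with the columns of `π`.
  toPP-surjective : ∀ π → ∃[ x ] π ≋ toPP x
  toPP-surjective σ@(π , _ , π≤m) = x , λ i j →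
    corners-injective
      (weaken (ℕ.m≤n+m J s) C)
      (weaken (ℕ.m≤m+n s J) (hulls-columns n m (matrix-boxed x)))
      same j i
    where
    J = proj₁ (columns σ)
    C = proj₂ (columns σ)
    c = flip (entry π)
    box = corners-boxed C (λ j i → π≤m i j)
    x = fromMatrix (corners J c)
    s = size n m (matrix x)
    same : ∀ i ℓ → corners (s + J) c i ℓ ≡ corners (s + J) (hulls n m (matrix x)) i ℓ
    same i ℓ = begin
      corners (s + J) c i ℓ
        ≡⟨ corners-weaken C s i ℓ ⟩
      corners J c i ℓ
        ≡⟨ matrix-fromMatrix box i ℓ ⟨
      matrix x i ℓ
        ≡⟨ corners-hulls n m (matrix-boxed x) (ℕ.m≤m+n s J) i ℓ ⟨
      corners (s + J) (hulls n m (matrix x)) i ℓ ∎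
      where open ≡-Reasoning

  -- The weights that `counts-∏₁`, applied twice to `counts-1/`, assigns to a matrix; their indices
  -- start at 1, as in the product.
  degₜ degq : Matrix → ℕ
  degₜ = total (λ i → total (λ j k → k))
  degq = total (λ i → total (λ j k → k ℕ.* (i + j ∸ 1)))

  sum-descents-partition : ∀ x (w : ℕ → ℕ → ℕ) →
    sum (map (λ (i , j) → w i (entry (partition x) i j)) (descents (partition x))) ≡
    ∑< m (λ ℓ → ∑< n (λ i → matrix x i ℓ ℕ.* w i (suc ℓ)))
  sum-descents-partition x w = trans
    (sum-descents (partition x) (hulls-columns n m (matrix-boxed x)) (proj₂ (proj₂ (toPP x))) w)
    (∑<-cong m (λ {ℓ} _ → ∑<-cong n (λ {i} _ →
      cong (ℕ._* w i (suc ℓ)) (corners-hulls n m (matrix-boxed x) ℕ.≤-refl i ℓ))))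

  des-partition : ∀ x → des (partition x) ≡ degₜ x
  des-partition x = begin
    des (partition x)
      ≡⟨ length≡sum-1 (descents (partition x)) ⟩
    sum (map (const 1) (descents (partition x)))
      ≡⟨ sum-descents-partition x (λ _ _ → 1) ⟩
    ∑< m (λ ℓ → ∑< n (λ i → matrix x i ℓ ℕ.* 1))
      ≡⟨ ∑<-cong m (λ {ℓ} _ → ∑<-cong n (λ {i} _ → ℕ.*-identityʳ (matrix x i ℓ))) ⟩
    ∑< m (λ ℓ → ∑< n (λ i → matrix x i ℓ))
      ≡⟨ total-matrix (λ _ _ k → k) x ⟨
    degₜ x ∎
    where
    open ≡-Reasoning
    length≡sum-1 : ∀ {A : Set} (xs : List A) → length xs ≡ sum (map (const 1) xs)
    length≡sum-1 []       = refl
    length≡sum-1 (_ ∷ xs) = cong suc (length≡sum-1 xs)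

  uh-partition : ∀ x → ∣ partition x ∣uh ≡ degq x
  uh-partition x = begin
    ∣ partition x ∣uh
      ≡⟨ sum-descents-partition x (λ i v → v + i) ⟩
    ∑< m (λ ℓ → ∑< n (λ i → matrix x i ℓ ℕ.* (suc ℓ + i)))
      -- The exponent in the product at indices `suc ℓ` and `suc i` is `suc ℓ + suc i ∸ 1`, which
      -- computes to `ℓ + suc i`.
      ≡⟨ ∑<-cong m (λ {ℓ} _ → ∑<-cong n (λ {i} _ → cong (matrix x i ℓ ℕ.*_) (ℕ.+-suc ℓ i))) ⟨
    ∑< m (λ ℓ → ∑< n (λ i → matrix x i ℓ ℕ.* (ℓ + suc i)))
      ≡⟨ total-matrix (λ i j k → k ℕ.* (i + j ∸ 1)) x ⟨
    degq x ∎
    where open ≡-Reasoning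

-- Comparison of coefficients.

t^q^-≢0 : ∀ {k l a b} → (t^ k q^ l) a b ≢ 0ℤ → k ≡ a × l ≡ b
t^q^-≢0 {k} {l} {a} {b} ≢0 with (k ℕ.≟ a) ×-dec (l ℕ.≟ b) in eq
... | yes k,l≡a,b = k,l≡a,b
... | no _        = ⊥-elim (≢0 (cong (λ d → if does d then 1ℤ else 0ℤ) eq))

sum-ones : ∀ {A : Set} (g : A → ℤ) xs → (∀ {x} → x ∈ xs → g x ≡ 1ℤ) →
           foldr ℤ._+_ 0ℤ (map g xs) ≡ ℤ.+ length xs
sum-ones g []       g≡1 = refl
sum-ones g (x ∷ xs) g≡1 = cong₂ ℤ._+_ (g≡1 (here refl)) (sum-ones g xs (g≡1 ∘ there))

theorem6p2 : (n m : ℕ) → n ≥ 1 → m ≥ 1 →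
    HasSum (PP∞ n m)
    (λ (π , _) → t^ des π q^ ∣ π ∣uh)
    (∏[1≤ i ≤ m ] ∏[1≤ j ≤ n ] (1/ (𝟙 - (t^ 1 q^ (i + j ∸ 1)))))
theorem6p2 n m _ _ a b =
  map (toPP n m) xs
  , SetoidUnique.map⁺ (setoid _) (PP∞ n m) (toPP-injective n m) (unique e)
  , complete′
  , (begin
      foldr ℤ._+_ 0ℤ (map coefficient (map (toPP n m) xs))
        ≡⟨ cong (foldr ℤ._+_ 0ℤ) (map-∘ xs) ⟨
      foldr ℤ._+_ 0ℤ (map (coefficient ∘ toPP n m) xs)
        -- Each listed partition contributes the monomial for `a` and `b`, hence exactly 1, so the
        -- sum is the length of the list.
        ≡⟨ sum-ones (coefficient ∘ toPP n m) xs (λ {x} x∈ → let (t , q) = sound e x∈ in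
             t^q^-≡1 (trans (des-partition n m x) t) (trans (uh-partition n m x) q)) ⟩
      ℤ.+ length xs
        ≡⟨ cardinality e ⟩
      _ ∎)
  where
  open ≡-Reasoning
  open Setoid (PP∞ n m) using (Carrier) renaming (sym to ≋-sym)
  open SetoidMembership (PP∞ n m) using () renaming (_∈_ to _∈PP_)
  e = counts-∏₁ (λ i → counts-∏₁ (λ j → counts-1/ (i + j ∸ 1)) n) m a b
  xs = elements e
  coefficient : Carrier → ℤ
  coefficient (π , _) = (t^ des π q^ ∣ π ∣uh) a b
  complete′ : ∀ π → coefficient π ≢ 0ℤ → π ∈PP map (toPP n m) xs
  complete′ σ@(π , _) ≢0 =
    -- A nonzero coefficient fixes both statistics of `π`. They carry over along `_≐_` to the
    -- partition of the matrix `x`, so `x` has weights `a` and `b` and is listed.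
    let (t , q)   = t^q^-≢0 ≢0
        (x , π≐x) = toPP-surjective n m σ
    in SetoidMembershipProperties.∈-resp-≈ (PP∞ n m) {x = toPP n m x} {y = σ}
         (≋-sym {σ} {toPP n m x} π≐x)
         (SetoidMembershipProperties.∈-map⁺ (setoid _) (PP∞ n m)
           {f = toPP n m} (λ { refl _ _ → refl }) {v = x}
           (complete e
             ( trans (sym (trans (des-cong π (partition n m x) π≐x) (des-partition n m x))) t
             , trans (sym (trans (∣∣uh-cong π (partition n m x) π≐x) (uh-partition n m x))) q)))
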